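{- Let $(T_n)_{n\ge -3}$ be the Padovan sequence. For every integer $n\ge 0$, $$T_n^3+T_{n-1}^3+T_{n-2}^3-T_nT_{n-1}^2-T_n^2T_{n-2}+T_{n-1}^2T_{n-2}+2T_{n-1}T_{n-2}^2-3T_nT_{n-1}T_{n-2}=1.$$
   Context: The Padovan sequence is the integer sequence defined by $T_0=0$, $T_1=1$, $T_2=1$ and $T_{n+3}=T_{n+1}+T_n$ for all $n\ge 0$, extended to negative indices by $T_{ -1}=1$, $T_{ -2}=0$, $T_{ -3}=0$ (so that the recurrence holds for all $n\ge -3$). -}

module Defs where

open import Data.Nat.Base using (suc)
open import Data.Integer.Base using (ℤ; +_; -[1+_]; 0ℤ; 1ℤ; _+_; _-_; -_)
open import Data.Integer.Properties using (+-comm; +-assoc; +-identityʳ; +-inverseʳ)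
open import Relation.Binary.PropositionalEquality using (_≡_; refl; sym; trans; cong; module ≡-Reasoning)

-- Below index -3 the sequence is continued by running the recurrence
-- backwards, T n = T (n + 3) - T (n + 1), so that T is total on ℤ without
-- junk values.
T : ℤ → ℤ
T (+ 0) = 0ℤ
T (+ 1) = 1ℤ
T (+ 2) = 1ℤ
T (+ suc (suc (suc n))) = T (+ suc n) + T (+ n)
T -[1+ 0 ] = 1ℤ
T -[1+ 1 ] = 0ℤ
T -[1+ 2 ] = 0ℤ
T -[1+ suc (suc (suc n)) ] = T -[1+ n ] - T -[1+ suc (suc n) ]

T-rec : ∀ n → T (n + + 3) ≡ T (n + + 1) + T n
T-rec n rewrite +-comm n (+ 3) | +-comm n (+ 1) = go n
  where
  cancel : ∀ a b → a ≡ b + (a - b)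
  cancel a b = sym (begin
    b + (a - b)    ≡⟨ +-comm b (a - b) ⟩
    a - b + b      ≡⟨ +-assoc a (- b) b ⟩
    a + (- b + b)  ≡⟨ cong (λ x → a + x) (trans (+-comm (- b) b) (+-inverseʳ b)) ⟩
    a + 0ℤ         ≡⟨ +-identityʳ a ⟩
    a              ∎)
    where open ≡-Reasoning

  go : ∀ n → T (+ 3 + n) ≡ T (+ 1 + n) + T n
  go (+ n) = refl
  go -[1+ 0 ] = refl
  go -[1+ 1 ] = refl
  go -[1+ 2 ] = refl
  go -[1+ suc (suc (suc n)) ] = cancel (T -[1+ n ]) (T -[1+ suc (suc n) ])

{-# OPTIONS --safe #-}
-- The cubic form is invariant under the linear map (x , y , z) ↦ (y + z , x , y),
-- which advances the index of three consecutive terms by one.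
module Submission where

open import Data.Integer.Base using (ℤ; +_; 0ℤ; 1ℤ; _+_; _-_; _*_; _^_; _≤_)
open import Data.Integer.Solver using (module +-*-Solver)
open import Data.Nat.Base using (ℕ; suc)
open import Relation.Binary.PropositionalEquality using (_≡_; refl; trans)
open import Defs

-- By the recurrence, the invariance (`cubicForm-step`) makes the form constant along consecutive
-- Padovan triples; at (T 0, T -1, T -2) = (0, 1, 0) its value is 1.

cubicForm : ℤ → ℤ → ℤ → ℤ
cubicForm x y z =
  x ^ 3 + y ^ 3 + z ^ 3
    - x * y ^ 2
    - x ^ 2 * z
    + y ^ 2 * z
    + + 2 * y * z ^ 2
    - + 3 * x * y * z

cubicForm-step : ∀ x y z → cubicForm (y + z) x y ≡ cubicForm x y z
cubicForm-step =
  solve 3 (λ x y z → form (y :+ z) x y := form x y z) refl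
  where
  open +-*-Solver
  form : ∀ {k} → Polynomial k → Polynomial k → Polynomial k → Polynomial k
  form x y z =
    x :^ 3 :+ y :^ 3 :+ z :^ 3
      :- x :* y :^ 2
      :- x :^ 2 :* z
      :+ y :^ 2 :* z
      :+ con (+ 2) :* y :* z :^ 2
      :- con (+ 3) :* x :* y :* z

cubicForm-T : ∀ (n : ℕ) → cubicForm (T (+ n)) (T (+ n - + 1)) (T (+ n - + 2)) ≡ 1ℤ
-- The recurrence clause of `T` applies only from index 3, so three cases are evaluated outright.
cubicForm-T 0 = refl
cubicForm-T 1 = refl
cubicForm-T 2 = refl
cubicForm-T (suc (suc (suc n))) =
  -- Here `y + z` is `T (+ suc (suc (suc n)))` by computation.
  trans (cubicForm-step (T (+ suc (suc n))) (T (+ suc n)) (T (+ n))) (cubicForm-T (suc (suc n)))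

mainTheorem3 : ∀ (n : ℤ) → 0ℤ ≤ n →
    T n ^ 3 + T (n - + 1) ^ 3 + T (n - + 2) ^ 3
    - T n * T (n - + 1) ^ 2
    - T n ^ 2 * T (n - + 2)
    + T (n - + 1) ^ 2 * T (n - + 2)
    + + 2 * T (n - + 1) * T (n - + 2) ^ 2
    - + 3 * T n * T (n - + 1) * T (n - + 2)
    ≡ 1ℤ
mainTheorem3 (+ n) _ = cubicForm-T n
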